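{- ${\rm fas}(3,6)=\frac{1}{6}$.
   Context: An oriented graph is a digraph without loops, multiple arcs or directed $2$-cycles. Degree of a vertex = in-degree + out-degree; directed girth = minimum length of a directed cycle ($\infty$ if none). For a digraph $D$, ${\rm fas}(D)$ is the minimum number of arcs of a feedback arc set (a set of arcs whose removal makes $D$ acyclic), and $a(D)=|A(D)|$. ${\rm fas}(\Delta,g)$ is the supremum of ${\rm fas}(D)/a(D)$ over all (unweighted) oriented graphs $D$ with at least one arc, maximum degree at most $\Delta$ and directed girth at least $g$. -}

module Defs where

open import Data.Nat using (ℕ; zero; suc; _+_; _*_; _≤_; _<_)
open import Data.Bool using (Bool; true; false; T; if_then_else_; _∧_; not)
open import Data.Fin using (Fin; zero; suc; fromℕ; inject₁)
open import Data.List using (List; map; allFin)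
open import Data.Nat.ListAction using (sum)
open import Data.Product using (Σ; _×_; ∃; _,_)
open import Data.Empty using (⊥)
open import Relation.Nullary using (¬_)
open import Relation.Binary.PropositionalEquality using (_≡_)
open import Function.Definitions using (Injective)

-- A digraph on vertex set Fin n, given by its (Boolean) arc relation:
-- there is an arc u → v iff  T (A u v).  This automatically excludes
-- multiple arcs.
Digraph : ℕ → Set
Digraph n = Fin n → Fin n → Bool

IsOriented : ∀ {n} → Digraph n → Set
IsOriented {n} A =
  (∀ (v : Fin n) → ¬ T (A v v)) × (∀ (u v : Fin n) → T (A u v) → ¬ T (A v u))

count : ∀ {n} → (Fin n → Bool) → ℕ
count {n} p = sum (map (λ i → if p i then 1 else 0) (allFin n))

arcs : ∀ {n} → Digraph n → ℕ
arcs {n} A = sum (map (λ u → count (λ v → A u v)) (allFin n))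

outdeg indeg degree : ∀ {n} → Digraph n → Fin n → ℕ
outdeg A v = count (λ u → A v u)
indeg A v = count (λ u → A u v)
degree A v = outdeg A v + indeg A v

MaxDegreeAtMost : ∀ {n} → Digraph n → ℕ → Set
MaxDegreeAtMost {n} A Δ = ∀ (v : Fin n) → degree A v ≤ Δ

nextIdx : ∀ {m} → Fin (suc m) → Fin (suc m)
nextIdx {zero} zero = zero
nextIdx {suc m} zero = suc zero
nextIdx {suc m} (suc i) with nextIdx {m} i
... | zero = zero
... | suc j = suc (suc j)

record DirectedCycle {n} (A : Digraph n) (m : ℕ) : Set where
  field
    vtx      : Fin (suc m) → Fin n
    distinct : Injective _≡_ _≡_ vtx
    arc      : ∀ (i : Fin (suc m)) → T (A (vtx i) (vtx (nextIdx i)))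

GirthAtLeast : ∀ {n} → Digraph n → ℕ → Set
GirthAtLeast A g = ∀ (m : ℕ) → DirectedCycle A m → g ≤ suc m

Acyclic : ∀ {n} → Digraph n → Set
Acyclic A = ∀ (m : ℕ) → DirectedCycle A m → ⊥

removeArcs : ∀ {n} → Digraph n → Digraph n → Digraph n
removeArcs A F u v = A u v ∧ not (F u v)

IsFAS : ∀ {n} → Digraph n → Digraph n → Set
IsFAS {n} A F = (∀ (u v : Fin n) → T (F u v) → T (A u v)) × Acyclic (removeArcs A F)

IsFas : ∀ {n} → Digraph n → ℕ → Set
IsFas {n} A f =
  (Σ (Digraph n) λ F → IsFAS A F × arcs F ≡ f)
  × (∀ (F : Digraph n) → IsFAS A F → f ≤ arcs F)

-- The class over which fas(Δ, g) takes its supremum.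
Admissible : ∀ {n} → Digraph n → ℕ → ℕ → Set
Admissible A Δ g = IsOriented A × (1 ≤ arcs A) × MaxDegreeAtMost A Δ × GirthAtLeast A g

module Submission where

open import Defs
open import Data.Nat using (ℕ; _+_; _*_; _≤_; _<_)
open import Data.Product using (Σ; _×_)

open import Data.Nat using (zero; suc; z≤n; s≤s; s≤s⁻¹; _≡ᵇ_; _≤ᵇ_)
open import Data.Nat.Properties hiding (_≟_)
open import Data.Nat.Divisibility
  using (_∣_; _∣?_; _∣0; divides; ∣-refl; ∣-trans; m∣m*n; ∣m∣n⇒∣m+n; ∣m+n∣m⇒∣n)
open import Data.Nat.Induction using (<-rec)
open import Data.Nat.ListAction using (sum)
open import Algebra.Properties.CommutativeSemigroup +-commutativeSemigroup using (interchange)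
open import Data.Bool using (Bool; true; false; T; if_then_else_; _∧_; _∨_; not)
open import Data.Bool.ListAction using (any; all)
open import Data.Bool.Properties using (T?; T-∧; T-∨)
open import Data.Fin using (Fin; zero; suc; toℕ; fromℕ; inject₁; _≟_)
open import Data.Fin.Patterns using (0F; 1F; 2F; 3F; 4F; 5F)
open import Data.Fin.Properties
  using (toℕ-injective; toℕ≤pred[n]; toℕ<n; any?; all?; ¬∀⟶∃¬; injective⇒≤)
open import Data.List using (List; []; _∷_; map; allFin; tabulate; length; foldr)
open import Data.List.Properties using (map-tabulate; length-map)
open import Data.List.Membership.Propositional using (_∈_)
open import Data.List.Relation.Unary.All as All using (All; []; _∷_)
import Data.List.Relation.Unary.All.Properties as All
open import Data.List.Relation.Unary.Any as Any using (here; there)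
import Data.List.Relation.Unary.Any.Properties as Any
open import Data.Vec using (Vec; []; _∷_)
open import Data.Product using (∃; ∃₂; _,_; proj₁; proj₂)
open import Data.Sum using (_⊎_; inj₁; inj₂; [_,_]′)
open import Data.Empty using (⊥-elim)
open import Data.Unit using (tt)
open import Function using (_∘_; id; case_of_; Equivalence)
open import Relation.Nullary using (¬_; yes; no; does; contradiction; ¬?; _×-dec_; _⊎-dec_; _→-dec_)
open import Relation.Nullary.Decidable using (decidable-stable; toWitness)
open import Relation.Binary.Definitions using (tri<; tri≈; tri>)
open import Relation.Binary.PropositionalEquality

-- Lower bound: the directed 6-cycle. Upper bound: induction on the number of
-- arcs. Arcs on no directed cycle are discarded, so every vertex with an arc has
-- in- and outdegree at least 1. If deleting some arc makes at least 6 arcs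
-- useless (itself included), one arc is charged to 6 and induction applies. A
-- local analysis finds such an arc whenever some vertex has degree 2. Otherwise
-- all degrees are 0 or 3, so 3 divides the number a of arcs, and deleting a
-- suitable arc makes 5 arcs useless; this gives 6 |F| ≤ a + 1, hence
-- 6 |F| ≤ a because 3 divides a and 6 |F|.

open DirectedCycle

private variable
  n m j k : ℕ

-- Finite sums and counting.

sum-map-+ : ∀ {X : Set} (f g : X → ℕ) xs →
  sum (map (λ x → f x + g x) xs) ≡ sum (map f xs) + sum (map g xs)
sum-map-+ f g []       = refl
sum-map-+ f g (x ∷ xs) =
  trans (cong (f x + g x +_) (sum-map-+ f g xs)) (interchange (f x) (g x) _ _)

sum-map-mono : ∀ {X : Set} {f g : X → ℕ} → (∀ x → f x ≤ g x) → ∀ xs →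
  sum (map f xs) ≤ sum (map g xs)
sum-map-mono f≤g []       = z≤n
sum-map-mono f≤g (x ∷ xs) = +-mono-≤ (f≤g x) (sum-map-mono f≤g xs)

sum-map-0 : ∀ {X : Set} (xs : List X) → sum (map (λ _ → 0) xs) ≡ 0
sum-map-0 []       = refl
sum-map-0 (x ∷ xs) = sum-map-0 xs

sum-map-swap : ∀ {X Y : Set} (f : X → Y → ℕ) xs ys →
  sum (map (λ x → sum (map (f x) ys)) xs) ≡ sum (map (λ y → sum (map (λ x → f x y) xs)) ys)
sum-map-swap f []       ys = sym (sum-map-0 ys)
sum-map-swap f (x ∷ xs) ys =
  trans (cong (sum (map (f x) ys) +_) (sum-map-swap f xs ys))
        (sym (sum-map-+ (f x) (λ y → sum (map (λ x → f x y) xs)) ys))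

[_]? : Bool → ℕ
[ b ]? = if b then 1 else 0

[]?-mono : ∀ {a b} → (T a → T b) → [ a ]? ≤ [ b ]?
[]?-mono {false}         _ = z≤n
[]?-mono {true}  {true}  _ = s≤s z≤n
[]?-mono {true}  {false} f = ⊥-elim (f tt)

count-mono : {p q : Fin n → Bool} → (∀ i → T (p i) → T (q i)) → count p ≤ count q
count-mono p⇒q = sum-map-mono (λ i → []?-mono (p⇒q i)) (allFin _)

sum-tabulate-0 : ∀ n → sum (tabulate {n = n} (λ _ → 0)) ≡ 0
sum-tabulate-0 zero    = refl
sum-tabulate-0 (suc n) = sum-tabulate-0 n

count-≟ : (x : Fin n) → count (λ i → does (i ≟ x)) ≡ 1
count-≟ {n} x = trans (cong sum (map-tabulate id (λ i → [ does (i ≟ x) ]?))) (go x)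
  where
  go : ∀ {n} (x : Fin n) → sum (tabulate (λ i → [ does (i ≟ x) ]?)) ≡ 1
  go {suc n} zero    = cong suc (sum-tabulate-0 n)
  go         (suc x) = go x

count-≥1 : (p : Fin n → Bool) {x : Fin n} → T (p x) → 1 ≤ count p
count-≥1 p {x} px = subst (_≤ count p) (count-≟ x) (count-mono member)
  where
  member : ∀ i → T (does (i ≟ x)) → T (p i)
  member i _ with yes refl ← i ≟ x = px

count-≥2 : (p : Fin n → Bool) {x y : Fin n} → x ≢ y → T (p x) → T (p y) → 2 ≤ count p
count-≥2 p {x} {y} x≢y px py =
  subst (_≤ count p)
        (trans (sum-map-+ (λ i → [ does (i ≟ x) ]?) (λ i → [ does (i ≟ y) ]?) (allFin _))
               (cong₂ _+_ (count-≟ x) (count-≟ y)))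
        (sum-map-mono bound (allFin _))
  where
  bound : ∀ i → [ does (i ≟ x) ]? + [ does (i ≟ y) ]? ≤ [ p i ]?
  bound i with i ≟ x | i ≟ y
  ... | yes refl | yes refl = ⊥-elim (x≢y refl)
  ... | yes refl | no _     = []?-mono (λ _ → px)
  ... | no _     | yes refl = []?-mono (λ _ → py)
  ... | no _     | no _     = z≤n

count-none : (p : Fin n → Bool) → (∀ i → ¬ T (p i)) → count p ≡ 0
count-none {n} p ¬p =
  n≤0⇒n≡0 (≤-trans (count-mono {q = λ _ → false} ¬p) (≤-reflexive (sum-map-0 (allFin n))))

-- Arc sets, their sizes, and cycles in subdigraphs.

infix 4 _⊆_
_⊆_ : Digraph n → Digraph n → Set
A ⊆ B = ∀ u v → T (A u v) → T (B u v)

infixl 6 _∪_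
_∪_ : Digraph n → Digraph n → Digraph n
(A ∪ B) u v = A u v ∨ B u v

single : Fin n → Fin n → Digraph n
single x y u v = does (u ≟ x) ∧ does (v ≟ y)

T-single : ∀ (x y u v : Fin n) → T (single x y u v) → u ≡ x × v ≡ y
T-single x y u v _ with yes p ← u ≟ x | yes q ← v ≟ y = p , q

arcs-single : (x y : Fin n) → arcs (single x y) ≡ 1
arcs-single {n} x y = ≤-antisym upper lower
  where
  row : ∀ u → count (single x y u) ≤ [ does (u ≟ x) ]?
  row u with u ≟ x
  ... | yes _ = ≤-reflexive (count-≟ y)
  ... | no _  = ≤-reflexive (sum-map-0 (allFin n))
  row′ : ∀ u → [ does (u ≟ x) ]? ≤ count (single x y u)
  row′ u with u ≟ x
  ... | yes _ = ≤-reflexive (sym (count-≟ y))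
  ... | no _  = z≤n
  upper = ≤-trans (sum-map-mono row (allFin n)) (≤-reflexive (count-≟ x))
  lower = ≤-trans (≤-reflexive (sym (count-≟ x))) (sum-map-mono row′ (allFin n))

-- Puts both arc counts under one double sum, so that the two bounds below reduce to a check of
-- truth values, cell by cell.
arcs-+ : (A B : Digraph n) →
  arcs A + arcs B ≡ sum (map (λ u → sum (map (λ v → [ A u v ]? + [ B u v ]?) (allFin n))) (allFin n))
arcs-+ {n} A B = trans
  (sym (sum-map-+ (λ u → count (A u)) (λ u → count (B u)) (allFin n)))
  (≤-antisym (sum-map-mono (λ u → ≤-reflexive (sym (row u))) (allFin n))
             (sum-map-mono (λ u → ≤-reflexive (row u)) (allFin n)))
  where
  row : ∀ u → sum (map (λ v → [ A u v ]? + [ B u v ]?) (allFin n)) ≡ count (A u) + count (B u)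
  row u = sum-map-+ (λ v → [ A u v ]?) (λ v → [ B u v ]?) (allFin n)

arcs-∪ : (A B : Digraph n) → arcs (A ∪ B) ≤ arcs A + arcs B
arcs-∪ {n} A B = subst (arcs (A ∪ B) ≤_) (sym (arcs-+ A B))
  (sum-map-mono (λ u → sum-map-mono (λ v → cell (A u v) (B u v)) (allFin n)) (allFin n))
  where
  cell : ∀ a b → [ a ∨ b ]? ≤ [ a ]? + [ b ]?
  cell true  _ = s≤s z≤n
  cell false _ = ≤-refl

arcs-∖ : {A B : Digraph n} → B ⊆ A → arcs (removeArcs A B) + arcs B ≤ arcs A
arcs-∖ {n} {A} {B} B⊆A = subst (_≤ arcs A) (sym (arcs-+ (removeArcs A B) B))
  (sum-map-mono (λ u → sum-map-mono (λ v → cell (A u v) (B u v) (B⊆A u v)) (allFin n)) (allFin n))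
  where
  cell : ∀ a b → (T b → T a) → [ a ∧ not b ]? + [ b ]? ≤ [ a ]?
  cell true  true  _ = ≤-refl
  cell true  false _ = ≤-refl
  cell false true  f = ⊥-elim (f tt)
  cell false false _ = ≤-refl

∑degree : (A : Digraph n) → sum (map (degree A) (allFin n)) ≡ arcs A + arcs A
∑degree {n} A = trans
  (sum-map-+ (outdeg A) (indeg A) (allFin n))
  (cong (arcs A +_) (sum-map-swap (λ v u → [ A u v ]?) (allFin n) (allFin n)))

∧-left : ∀ {a b} → T (a ∧ b) → T a
∧-left {true} _ = tt

removeArcs-⊆ : (A F : Digraph n) → removeArcs A F ⊆ A
removeArcs-⊆ A F u v = ∧-left

T-∖ : ∀ {a b} → T a → ¬ T b → T (a ∧ not b)
T-∖ {true} {true}  _ ¬b = ¬b tt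
T-∖ {true} {false} _ _  = tt

reroute : {A B : Digraph n} (C : DirectedCycle A m) →
  (∀ i → T (B (vtx C i) (vtx C (nextIdx i)))) → DirectedCycle B m
reroute C arc′ = record { vtx = vtx C ; distinct = distinct C ; arc = arc′ }

cycle-mono : {A B : Digraph n} → A ⊆ B → DirectedCycle A m → DirectedCycle B m
cycle-mono A⊆B C = reroute C (λ i → A⊆B _ _ (arc C i))

Sparse : Digraph n → Set
Sparse A = MaxDegreeAtMost A 3 × GirthAtLeast A 6

Sparse-⊆ : {A B : Digraph n} → A ⊆ B → Sparse B → Sparse A
Sparse-⊆ A⊆B (deg , girth) =
  (λ v → ≤-trans (+-mono-≤ (count-mono (A⊆B v)) (count-mono (λ u → A⊆B u v))) (deg v)) ,
  (λ m C → girth m (cycle-mono A⊆B C))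

-- Cyclic indices and short closed walks.

nextIdx-view : (i : Fin (suc m)) →
  (nextIdx i ≡ zero × toℕ i ≡ m) ⊎ toℕ (nextIdx i) ≡ suc (toℕ i)
nextIdx-view {zero}  zero    = inj₁ (refl , refl)
nextIdx-view {suc m} zero    = inj₂ refl
nextIdx-view {suc m} (suc i) with nextIdx i | nextIdx-view i
... | zero  | inj₁ (_ , e) = inj₁ (refl , cong suc e)
... | suc _ | inj₂ e       = inj₂ (cong suc e)

nextIdx-fromℕ : ∀ m → nextIdx (fromℕ m) ≡ zero
nextIdx-fromℕ zero = refl
nextIdx-fromℕ (suc m) rewrite nextIdx-fromℕ m = refl

nextIdx-inject₁ : (i : Fin m) → nextIdx (inject₁ i) ≡ suc i
nextIdx-inject₁ zero = refl
nextIdx-inject₁ {suc (suc m)} (suc i) rewrite nextIdx-inject₁ i = refl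

nextIdx-surjective : (j : Fin (suc m)) → ∃ λ i → nextIdx i ≡ j
nextIdx-surjective zero    = _ , nextIdx-fromℕ _
nextIdx-surjective (suc j) = _ , nextIdx-inject₁ j

-- Strong induction on the length: a closed walk that repeats a vertex contains a shorter closed
-- walk, and one that does not is a directed cycle below the girth.
no-short-loop : ∀ {A : Digraph n} {g} → GirthAtLeast A g →
  ∀ k → suc k < g → (s : ℕ → Fin n) →
  (∀ i → i ≤ k → T (A (s i) (s (suc i)))) → s (suc k) ≢ s 0
no-short-loop {n} {A} {g} girth = <-rec _ step
  where
  Goal : ℕ → Set
  Goal k = suc k < g → (s : ℕ → Fin n) →
    (∀ i → i ≤ k → T (A (s i) (s (suc i)))) → s (suc k) ≢ s 0
  step : ∀ k → (∀ {l} → l < k → Goal l) → Goal k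
  step k rec k<g s arc closes = <⇒≱ k<g (girth k record
    { vtx = s ∘ toℕ ; distinct = inj ; arc = arc′ })
    where
    arc′ : ∀ i → T (A (s (toℕ i)) (s (toℕ (nextIdx i))))
    arc′ i with nextIdx-view i
    ... | inj₁ (e , last) rewrite last | e | sym closes = arc _ ≤-refl
    ... | inj₂ e          rewrite e = arc _ (toℕ≤pred[n] i)
    no-chord : ∀ a b → a < b → b ≤ k → s b ≢ s a
    -- Here `b = a + d + 1`, so a repetition closes a walk of `d + 1` arcs.
    no-chord a b a<b b≤k with d , refl ← m≤n⇒∃[o]m+o≡n a<b = λ e →
      rec (≤-trans (s≤s (m≤n+m d a)) b≤k) (<-trans (s≤s d<k) k<g) (λ i → s (i + a))
        (λ i i≤d → arc (i + a) (≤-trans (≤-trans (+-monoˡ-≤ a i≤d) (≤-reflexive (+-comm d a)))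
                                        (≤-trans (n≤1+n _) b≤k)))
        (trans (cong (s ∘ suc) (+-comm d a)) e)
      where
      d<k : d < k
      d<k = ≤-trans (s≤s (m≤n+m d a)) b≤k
    inj : ∀ {i j} → s (toℕ i) ≡ s (toℕ j) → i ≡ j
    inj {i} {j} e with <-cmp (toℕ i) (toℕ j)
    ... | tri< i<j _ _ = ⊥-elim (no-chord _ _ i<j (toℕ≤pred[n] j) (sym e))
    ... | tri≈ _ i≡j _ = toℕ-injective i≡j
    ... | tri> _ _ j<i = ⊥-elim (no-chord _ _ j<i (toℕ≤pred[n] i) e)

-- Walks with at least one and at most the given number of arcs.
data Walk (A : Digraph n) : ℕ → Fin n → Fin n → Set where
  [_] : ∀ {u v} → T (A u v) → Walk A (suc j) u v
  _∷_ : ∀ {u v w} → T (A u v) → Walk A j v w → Walk A (suc j) u w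

module _ {A : Digraph n} where

  -- One less than the number of arcs, the length convention of `no-short-loop`.
  extent : ∀ {u v} → Walk A j u v → ℕ
  extent [ _ ]   = 0
  extent (_ ∷ w) = suc (extent w)

  extent-< : ∀ {u v} (w : Walk A j u v) → extent w < j
  extent-< [ _ ]   = s≤s z≤n
  extent-< (_ ∷ w) = s≤s (extent-< w)

  at : ∀ {u v} → Walk A j u v → ℕ → Fin n
  at {u = u} w         zero    = u
  at {v = v} [ _ ]     (suc i) = v
  at         (_ ∷ w)   (suc i) = at w i

  at-arc : ∀ {u v} (w : Walk A j u v) i → i ≤ extent w → T (A (at w i) (at w (suc i)))
  at-arc [ p ]         zero    _         = p
  at-arc (p ∷ [ _ ])   zero    _         = p
  at-arc (p ∷ (_ ∷ _)) zero    _         = p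
  at-arc (p ∷ w)       (suc i) (s≤s i≤l) = at-arc w i i≤l

  at-end : ∀ {u v} (w : Walk A j u v) → at w (suc (extent w)) ≡ v
  at-end [ _ ]   = refl
  at-end (_ ∷ w) = at-end w

  no-short-closed : GirthAtLeast A 6 → ∀ {u} → ¬ Walk A 5 u u
  no-short-closed girth w =
    no-short-loop girth (extent w) (s≤s (extent-< w)) (at w) (at-arc w) (at-end w)

-- Feedback arc sets under deletion of one arc.

HasFAS : Digraph n → ℕ → Set
HasFAS A N = Σ (Digraph _) λ F → IsFAS A F × 6 * arcs F ≤ N

delete : Digraph n → Fin n × Fin n → Digraph n
delete A (x , y) = removeArcs A (single x y)

module _ (A : Digraph n) {x y : Fin n} where

  delete-⊆ : delete A (x , y) ⊆ A
  delete-⊆ = removeArcs-⊆ A (single x y)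

  T-delete : ∀ {u v} → T (A u v) → u ≢ x ⊎ v ≢ y → T (delete A (x , y) u v)
  T-delete {u} {v} p (inj₁ u≢x) = T-∖ p (u≢x ∘ proj₁ ∘ T-single x y u v)
  T-delete {u} {v} p (inj₂ v≢y) = T-∖ p (v≢y ∘ proj₂ ∘ T-single x y u v)

  T-delete-≢ : ¬ T (delete A (x , y) x y)
  T-delete-≢ h with A x y | x ≟ x | y ≟ y
  ... | true | yes _  | yes _  = h
  ... | _    | no x≢x | _      = x≢x refl
  ... | _    | _      | no y≢y = y≢y refl

  arcs-delete : T (A x y) → suc (arcs (delete A (x , y))) ≤ arcs A
  arcs-delete p = ≤-trans
    (≤-reflexive (trans (+-comm 1 _) (cong (arcs (delete A (x , y)) +_) (sym (arcs-single x y)))))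
    (arcs-∖ single⊆A)
    where
    single⊆A : single x y ⊆ A
    single⊆A u v h with refl , refl ← T-single x y u v h = p

  -- The deleted arc joins the feedback arc set at a cost of 6.
  HasFAS-delete : ∀ {N} → T (A x y) → HasFAS (delete A (x , y)) N → HasFAS A (6 + N)
  HasFAS-delete {N} p (F , (F⊆ , acyclic) , 6F≤N) =
    F ∪ single x y , (sub , λ m C → acyclic m (cycle-mono shrink C)) , size
    where
    sub : F ∪ single x y ⊆ A
    sub u v h with F u v in e
    ... | true  = delete-⊆ u v (F⊆ u v (subst T (sym e) _))
    ... | false with refl , refl ← T-single x y u v h = p
    shrink : removeArcs A (F ∪ single x y) ⊆ removeArcs (delete A (x , y)) F
    shrink u v = bool (A u v) (F u v) (single x y u v)
      where
      bool : ∀ a f s → T (a ∧ not (f ∨ s)) → T ((a ∧ not s) ∧ not f)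
      bool true false false h = h
    size : 6 * arcs (F ∪ single x y) ≤ 6 + N
    size = begin
      6 * arcs (F ∪ single x y)           ≤⟨ *-monoʳ-≤ 6 (arcs-∪ F (single x y)) ⟩
      6 * (arcs F + arcs (single x y))    ≡⟨ cong (λ s → 6 * (arcs F + s)) (arcs-single x y) ⟩
      6 * (arcs F + 1)                    ≡⟨ cong (6 *_) (+-comm (arcs F) 1) ⟩
      6 * suc (arcs F)                    ≡⟨ *-suc 6 (arcs F) ⟩
      6 + 6 * arcs F                      ≤⟨ +-monoʳ-≤ 6 6F≤N ⟩
      6 + N                               ∎
      where open ≤-Reasoning

  -- A local condition keeping the arc from `x` to `y` off every directed cycle, which would have to
  -- enter `x` and leave `y`.
  Dead : Set
  Dead = (∀ z → ¬ T (A z x)) ⊎ (∀ z → ¬ T (A y z))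

  cycle-avoids-dead : Dead → (C : DirectedCycle A m) →
    ∀ i → vtx C i ≢ x ⊎ vtx C (nextIdx i) ≢ y
  cycle-avoids-dead (inj₁ no-in) C i with h , refl ← nextIdx-surjective i =
    inj₁ λ { refl → no-in _ (arc C h) }
  cycle-avoids-dead (inj₂ no-out) C i =
    inj₂ λ { refl → no-out _ (arc C (nextIdx i)) }

  -- The same `F` serves at no cost: a cycle of `A` avoiding `F` also avoids the dead arc, hence
  -- lies in the smaller digraph.
  HasFAS-dead : ∀ {N} → Dead → HasFAS (delete A (x , y)) N → HasFAS A N
  HasFAS-dead dead (F , (F⊆ , acyclic) , size) =
    F , ((λ u v → delete-⊆ u v ∘ F⊆ u v) , acyclic′) , size
    where
    acyclic′ : Acyclic (removeArcs A F)
    acyclic′ m C = acyclic m (reroute C λ i →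
      let p = arc C i in
      T-∖ (T-delete (∧-left p) (cycle-avoids-dead dead (cycle-mono (removeArcs-⊆ A F) C) i))
          (∧-right p))
      where
      ∧-right : ∀ {a b} → T (a ∧ not b) → ¬ T b
      ∧-right {true} {false} _ ()

-- Successive deletion of arcs.

infixl 6 _∖_
_∖_ : Digraph n → List (Fin n × Fin n) → Digraph n
A ∖ R = foldr (λ e B → delete B e) A R

Fresh : Fin n × Fin n → List (Fin n × Fin n) → Set
Fresh (x , y) = All (λ (u , v) → x ≢ u ⊎ y ≢ v)

∖-⊆ : (A : Digraph n) → ∀ R → A ∖ R ⊆ A
∖-⊆ A []      u v p = p
∖-⊆ A (e ∷ R) u v p = ∖-⊆ A R u v (delete-⊆ (A ∖ R) u v p)

T-∖-fresh : (A : Digraph n) → ∀ {R u v} → T (A u v) → Fresh (u , v) R → T ((A ∖ R) u v)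
T-∖-fresh A p []       = p
T-∖-fresh A {_ ∷ R} p (d ∷ ds) = T-delete (A ∖ R) (T-∖-fresh A p ds) d

∖-∈ : (A : Digraph n) → ∀ {R u v} → (u , v) ∈ R → ¬ T ((A ∖ R) u v)
∖-∈ A {_ ∷ R} (here refl) h = T-delete-≢ (A ∖ R) h
∖-∈ A {_ ∷ R} (there e)   h = ∖-∈ A e (delete-⊆ (A ∖ R) _ _ h)

-- Kills A R: the arcs of R can be deleted from A, last to first, all but the
-- first of them lying on no directed cycle at the time of their deletion.
data Kills (A : Digraph n) : List (Fin n × Fin n) → Set where
  cut  : ∀ {x y} → T (A x y) → Kills A ((x , y) ∷ [])
  dead : ∀ {x y R} → Kills A R → T (A x y) → Fresh (x , y) R →
         (∀ z → T (A z x) → (z , x) ∈ R) ⊎ (∀ z → T (A y z) → (y , z) ∈ R) →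
         Kills A ((x , y) ∷ R)

Kills-arcs : (A : Digraph n) → ∀ {R} → Kills A R → length R + arcs (A ∖ R) ≤ arcs A
Kills-arcs A (cut p) = arcs-delete A p
Kills-arcs A {_ ∷ R} (dead K p fresh _) =
  ≤-trans (≤-reflexive (sym (+-suc (length R) _)))
          (≤-trans (+-monoʳ-≤ (length R) (arcs-delete (A ∖ R) (T-∖-fresh A p fresh)))
                   (Kills-arcs A K))

-- Only the initial cut costs 6. Every later arc is dead when deleted, since all arcs into its tail,
-- or all arcs out of its head, are already gone.
Kills-HasFAS : (A : Digraph n) → ∀ {R N} → Kills A R → HasFAS (A ∖ R) N → HasFAS A (6 + N)
Kills-HasFAS A (cut p) = HasFAS-delete A p
Kills-HasFAS A {_ ∷ R} (dead {x} {y} K _ _ d) =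
  Kills-HasFAS A K ∘ HasFAS-dead (A ∖ R) (case d of λ
    { (inj₁ f) → inj₁ λ z h → ∖-∈ A (f z (∖-⊆ A R _ _ h)) h
    ; (inj₂ f) → inj₂ λ z h → ∖-∈ A (f z (∖-⊆ A R _ _ h)) h })

Killing : Digraph n → ℕ → Set
Killing A c = Σ (List _) λ R → Kills A R × c ≤ length R

-- Symbolic computation of killed arcs and its soundness.

OnlyIn OnlyOut : Digraph n → Fin n → Fin n → Set
OnlyIn  A x y = ∀ z → T (A z y) → z ≡ x
OnlyOut A x y = ∀ z → T (A x z) → z ≡ y

-- Local configurations are described on numbered vertices, so that counting
-- the arcs killed by a deletion is a closed boolean computation.
-- x ⟶! y : x is the only possible in-neighbour of y;
-- x !⟶ y : y is the only possible out-neighbour of x;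
-- x # y  : x and y are distinct.
infix 6 _⟶_ _⟶!_ _!⟶_ _#_
data Fact : Set where
  _⟶_ _⟶!_ _!⟶_ _#_ : ℕ → ℕ → Fact

Arcs : Set
Arcs = List (ℕ × ℕ)

module Pattern (Γ : List Fact) where

  walk : ℕ → ℕ → ℕ → Bool
  walk-via : ℕ → ℕ → ℕ → Fact → Bool
  walk zero    x y = false
  walk (suc j) x y = any (walk-via j x y) Γ
  walk-via j x y (u ⟶ v) = (u ≡ᵇ x) ∧ ((v ≡ᵇ y) ∨ walk j v y)
  walk-via j x y _       = false

  separates : ℕ → ℕ → Fact → Bool
  separates x y (u # v) = (u ≡ᵇ x) ∧ (v ≡ᵇ y)
  separates x y _       = false

  -- By the girth condition, a walk of at most 5 arcs has distinct ends.
  apart : ℕ → ℕ → Bool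
  apart x y = any (separates x y) Γ ∨ any (separates y x) Γ ∨ walk 5 x y ∨ walk 5 y x

  fresh : ℕ → ℕ → Arcs → Bool
  fresh x y = all λ (u , v) → apart x u ∨ apart y v

  member : ℕ → ℕ → Arcs → Bool
  member x y = any λ (u , v) → (x ≡ᵇ u) ∧ (y ≡ᵇ v)

  kills : ℕ → ℕ → Arcs → Fact → Bool
  kills x y R (u ⟶! v) = (v ≡ᵇ x) ∧ member u v R
  kills x y R (u !⟶ v) = (u ≡ᵇ y) ∧ member u v R
  kills x y R _        = false

  extend : Fact → Arcs → Arcs
  extend (x ⟶ y) R = if any (kills x y R) Γ ∧ fresh x y R then (x , y) ∷ R else R
  extend _       R = R

  saturate : ℕ → Arcs → Arcs
  saturate zero    R = R
  saturate (suc i) R = saturate i (foldr extend R Γ)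

-- Indices beyond the end of the vector denote its last entry.
pick : Vec (Fin n) (suc k) → ℕ → Fin n
pick (x ∷ [])    _       = x
pick (x ∷ _ ∷ _) zero    = x
pick (_ ∷ y ∷ v) (suc i) = pick (y ∷ v) i

module Search {A : Digraph n} (no-short : ∀ {u} → ¬ Walk A 5 u u) {k} (vs : Vec (Fin n) (suc k)) where

  ρ : ℕ → Fin n
  ρ = pick vs

  ⟦_⟧ : Fact → Set
  ⟦ x ⟶ y ⟧  = T (A (ρ x) (ρ y))
  ⟦ x ⟶! y ⟧ = OnlyIn A (ρ x) (ρ y)
  ⟦ x !⟶ y ⟧ = OnlyOut A (ρ x) (ρ y)
  ⟦ x # y ⟧  = ρ x ≢ ρ y

  image : Arcs → List (Fin n × Fin n)
  image = map λ (x , y) → ρ x , ρ y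

  module Sound {Γ : List Fact} (evidence : All ⟦_⟧ Γ) where
    open Pattern Γ

    search : {P : Set} (p : Fact → Bool) → (∀ φ → ⟦ φ ⟧ → T (p φ) → P) → T (any p Γ) → P
    search p found h =
      let holds , selected = All.lookupAny evidence (Any.any⁻ p Γ h) in found _ holds selected

    walk-sound : ∀ j x y → T (walk j x y) → Walk A j (ρ x) (ρ y)
    walk-sound (suc j) x y = search (walk-via j x y) λ where
      (u ⟶ v) p h → let h₁ , h₂ = Equivalence.to T-∧ h in
        subst (λ t → Walk A _ (ρ t) _) (≡ᵇ⇒≡ u x h₁) (case Equivalence.to T-∨ h₂ of λ where
          (inj₁ e) → subst (λ t → Walk A _ _ (ρ t)) (≡ᵇ⇒≡ v y e) [ p ]
          (inj₂ w) → p ∷ walk-sound j v y w)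

    separates-sound : ∀ x y → T (any (separates x y) Γ) → ρ x ≢ ρ y
    separates-sound x y = search (separates x y) λ where
      (u # v) p h → let h₁ , h₂ = Equivalence.to T-∧ h in
        subst₂ (λ s t → ρ s ≢ ρ t) (≡ᵇ⇒≡ u x h₁) (≡ᵇ⇒≡ v y h₂) p

    apart-sound : ∀ x y → T (apart x y) → ρ x ≢ ρ y
    apart-sound x y h with Equivalence.to (T-∨ {any (separates x y) Γ}) h
    ... | inj₁ s = separates-sound x y s
    ... | inj₂ h with Equivalence.to (T-∨ {any (separates y x) Γ}) h
    ...   | inj₁ s = separates-sound y x s ∘ sym
    ...   | inj₂ h with Equivalence.to (T-∨ {walk 5 x y}) h
    ...     | inj₁ w = λ e → no-short (subst (Walk A 5 _) (sym e) (walk-sound 5 x y w))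
    ...     | inj₂ w = λ e → no-short (subst (Walk A 5 _) e (walk-sound 5 y x w))

    fresh-sound : ∀ x y R → T (fresh x y R) → Fresh (ρ x , ρ y) (image R)
    fresh-sound x y []            _ = []
    fresh-sound x y ((u , v) ∷ R) h with h₁ , h₂ ← Equivalence.to (T-∧ {apart x u ∨ apart y v}) h =
      (case Equivalence.to (T-∨ {apart x u}) h₁ of λ where
        (inj₁ a) → inj₁ (apart-sound x u a)
        (inj₂ a) → inj₂ (apart-sound y v a))
      ∷ fresh-sound x y R h₂

    member-sound : ∀ x y R → T (member x y R) → (ρ x , ρ y) ∈ image R
    member-sound x y R h = Any.map⁺ (Any.map
      (λ {(u , v)} e → let e₁ , e₂ = Equivalence.to T-∧ e in
        cong₂ (λ s t → ρ s , ρ t) (≡ᵇ⇒≡ x u e₁) (≡ᵇ⇒≡ y v e₂))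
      (Any.any⁻ _ R h))

    kills-sound : ∀ x y R → T (any (kills x y R) Γ) →
      (∀ z → T (A z (ρ x)) → (z , ρ x) ∈ image R) ⊎ (∀ z → T (A (ρ y) z) → (ρ y , z) ∈ image R)
    kills-sound x y R = search (kills x y R) λ where
      (u ⟶! v) only h → let h₁ , h₂ = Equivalence.to T-∧ h in inj₁ (
        subst (λ t → ∀ z → T (A z (ρ t)) → (z , ρ t) ∈ image R) (≡ᵇ⇒≡ v x h₁)
          λ z z→v → subst (λ s → (s , ρ v) ∈ image R) (sym (only z z→v)) (member-sound u v R h₂))
      (u !⟶ v) only h → let h₁ , h₂ = Equivalence.to T-∧ h in inj₂ (
        subst (λ t → ∀ z → T (A (ρ t) z) → (ρ t , z) ∈ image R) (≡ᵇ⇒≡ u y h₁)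
          λ z u→z → subst (λ s → (ρ u , s) ∈ image R) (sym (only z u→z)) (member-sound u v R h₂))

    extend-sound : ∀ φ → ⟦ φ ⟧ → ∀ {R} → Kills A (image R) → Kills A (image (extend φ R))
    extend-sound (x ⟶ y) p {R} K with any (kills x y R) Γ in e₁ | fresh x y R in e₂
    ... | false | _     = K
    ... | true  | false = K
    ... | true  | true  =
      dead K p (fresh-sound x y R (subst T (sym e₂) _)) (kills-sound x y R (subst T (sym e₁) _))
    extend-sound (_ ⟶! _) _ K = K
    extend-sound (_ !⟶ _) _ K = K
    extend-sound (_ # _)  _ K = K

    -- The traversed list `Δ` is separated from `Γ`, which every extension still consults in full.
    foldr-extend-sound : ∀ {Δ} → All ⟦_⟧ Δ → ∀ {R} → Kills A (image R) → Kills A (image (foldr extend R Δ))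
    foldr-extend-sound []               K = K
    foldr-extend-sound {φ ∷ _} (p ∷ ps) K = extend-sound φ p (foldr-extend-sound ps K)

    saturate-sound : ∀ i {R} → Kills A (image R) → Kills A (image (saturate i R))
    saturate-sound zero    K = K
    saturate-sound (suc i) K = saturate-sound i (foldr-extend-sound evidence K)

  Facts : Set
  Facts = List (Σ Fact ⟦_⟧)

  killed : ∀ {x y} → ⟦ x ⟶ y ⟧ → Facts → ℕ → Arcs
  -- Each pass adds an arc or has reached a fixed point, so `c` passes from one arc find `c` arcs
  -- whenever further passes could.
  killed {x} {y} _ Γ c = Pattern.saturate (x ⟶ y ∷ map proj₁ Γ) c ((x , y) ∷ [])

  -- For a concrete configuration the implicit argument reduces to the unit type, so type checking
  -- itself runs the saturation. The numbers `x` and `y` name the arc that is cut.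
  killing : ∀ c x y (p : ⟦ x ⟶ y ⟧) (Γ : Facts) {_ : T (c ≤ᵇ length (killed {x} {y} p Γ c))} → Killing A c
  killing c x y p Γ {h} =
    image R , Sound.saturate-sound (p ∷ All.map⁺ (All.universal proj₂ Γ)) c (cut p) ,
    subst (c ≤_) (sym (length-map _ R)) (≤ᵇ⇒≤ c _ h)
    where
    R = killed {x} {y} p Γ c

-- Divisibility of sums.

∣-sum : ∀ {X : Set} {d} {f : X → ℕ} → (∀ x → d ∣ f x) → ∀ xs → d ∣ sum (map f xs)
∣-sum {d = d} d∣ []       = d ∣0
∣-sum         d∣ (x ∷ xs) = ∣m∣n⇒∣m+n (d∣ x) (∣-sum d∣ xs)

triple : ∀ a → a * 3 ≡ (a + a) + a
triple a = trans (*-comm a 3) (trans (cong (λ t → a + (a + t)) (+-identityʳ a)) (sym (+-assoc a a a)))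

-- Local analysis when every arc can be continued in both directions.

module Core {A : Digraph n}
  (deg : MaxDegreeAtMost A 3)
  (no-short : ∀ {u} → ¬ Walk A 5 u u)
  (has-in  : ∀ {x y} → T (A x y) → ∃ λ z → T (A z x))
  (has-out : ∀ {x y} → T (A x y) → ∃ λ z → T (A y z))
  where

  open Search {A = A} no-short using (killing)

  in-split : ∀ x y → OnlyIn A x y ⊎ ∃ λ z → z ≢ x × T (A z y)
  in-split x y with any? (λ z → ¬? (z ≟ x) ×-dec T? (A z y))
  ... | yes other = inj₂ other
  ... | no  none  = inj₁ λ z z→y → decidable-stable (z ≟ x) (λ z≢x → none (z , z≢x , z→y))

  out-split : ∀ x y → OnlyOut A x y ⊎ ∃ λ z → z ≢ y × T (A x z)
  out-split x y with any? (λ z → ¬? (z ≟ y) ×-dec T? (A x z))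
  ... | yes other = inj₂ other
  ... | no  none  = inj₁ λ z x→z → decidable-stable (z ≟ y) (λ z≢y → none (z , z≢y , x→z))

  -- A second out-neighbour would give `t` degree at least 4.
  merge-only-out : ∀ {a b t v} → a ≢ b → T (A a t) → T (A b t) → T (A t v) → OnlyOut A t v
  merge-only-out {t = t} {v} a≢b a→t b→t t→v z t→z = decidable-stable (z ≟ v) λ z≢v →
    <⇒≱ (+-mono-≤ (count-≥2 (A t) z≢v t→z t→v) (count-≥2 (λ u → A u t) a≢b a→t b→t)) (deg t)

  -- In the lemmas named merge…, t is a vertex with two in-neighbours a and b;
  -- since degrees are at most 3, its out-neighbour v is unique.
  merge-merge : ∀ {a b c t v} → a ≢ b → T (A a t) → T (A b t) → T (A t v) → c ≢ t → T (A c v) → Killing A 6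
  merge-merge {a} {b} {c} {t} {v} a≢b a→t b→t t→v c≢t c→v with has-out t→v
  ... | x , v→x with has-out v→x | in-split v x | merge-only-out a≢b a→t b→t t→v | merge-only-out c≢t c→v t→v v→x
  -- The cut kills the four arcs into `t` and `v` behind it and the arc from `x` to `y` ahead.
  ...   | y , x→y | inj₁ v→!x | t!→v | v!→x = killing
            (a ∷ b ∷ t ∷ v ∷ c ∷ x ∷ y ∷ []) 6 3 5 v→x
            ((0 ⟶ 2 , a→t) ∷ (1 ⟶ 2 , b→t) ∷ (2 ⟶ 3 , t→v) ∷ (4 ⟶ 3 , c→v) ∷ (5 ⟶ 6 , x→y) ∷
             (2 !⟶ 3 , t!→v) ∷ (3 !⟶ 5 , v!→x) ∷ (3 ⟶! 5 , v→!x) ∷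
             (0 # 1 , a≢b) ∷ (4 # 2 , c≢t) ∷ [])
  -- Now `x` merges too, so its only out-arc is cut and death spreads backwards through `x`, `v` and
  -- `t`.
  ...   | y , x→y | inj₂ (d , d≢v , d→x) | t!→v | v!→x = killing
            (a ∷ b ∷ t ∷ v ∷ c ∷ x ∷ y ∷ d ∷ []) 6 5 6 x→y
            ((0 ⟶ 2 , a→t) ∷ (1 ⟶ 2 , b→t) ∷ (2 ⟶ 3 , t→v) ∷ (4 ⟶ 3 , c→v) ∷ (3 ⟶ 5 , v→x) ∷
             (7 ⟶ 5 , d→x) ∷
             (2 !⟶ 3 , t!→v) ∷ (3 !⟶ 5 , v!→x) ∷ (5 !⟶ 6 , merge-only-out d≢v d→x v→x x→y) ∷
             (0 # 1 , a≢b) ∷ (4 # 2 , c≢t) ∷ (7 # 3 , d≢v) ∷ [])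

  -- If `x` or `y` merges, its out-arc is cut and death spreads back to `a` and `b`. Otherwise the
  -- arc from `t` to `v` is cut: both arcs into `t` die, and so do three arcs ahead.
  merge-straight : ∀ {a b t v x} → a ≢ b → T (A a t) → T (A b t) → T (A t v) → OnlyIn A t v →
    T (A v x) → OnlyOut A v x → Killing A 6
  merge-straight {a} {b} {t} {v} {x} a≢b a→t b→t t→v t→!v v→x v!→x
    with has-out v→x | in-split v x | merge-only-out a≢b a→t b→t t→v
  ... | y , x→y | inj₂ (d , d≢v , d→x) | t!→v = killing
            (a ∷ b ∷ t ∷ v ∷ d ∷ x ∷ y ∷ []) 6 5 6 x→y
            ((0 ⟶ 2 , a→t) ∷ (1 ⟶ 2 , b→t) ∷ (2 ⟶ 3 , t→v) ∷ (3 ⟶ 5 , v→x) ∷ (4 ⟶ 5 , d→x) ∷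
             (2 !⟶ 3 , t!→v) ∷ (3 !⟶ 5 , v!→x) ∷ (5 !⟶ 6 , merge-only-out d≢v d→x v→x x→y) ∷
             (0 # 1 , a≢b) ∷ (4 # 3 , d≢v) ∷ [])
  ... | y , x→y | inj₁ v→!x | t!→v with out-split x y
  ...   | inj₂ (y′ , y′≢y , x→y′) = killing
              (a ∷ b ∷ t ∷ v ∷ x ∷ y ∷ y′ ∷ []) 6 2 3 t→v
              ((0 ⟶ 2 , a→t) ∷ (1 ⟶ 2 , b→t) ∷ (3 ⟶ 4 , v→x) ∷ (4 ⟶ 5 , x→y) ∷ (4 ⟶ 6 , x→y′) ∷
               (2 !⟶ 3 , t!→v) ∷ (2 ⟶! 3 , t→!v) ∷ (3 ⟶! 4 , v→!x) ∷
               (0 # 1 , a≢b) ∷ (6 # 5 , y′≢y) ∷ [])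
  ...   | inj₁ x!→y with has-out x→y | in-split x y
  ...     | z , y→z | inj₁ x→!y = killing
                (a ∷ b ∷ t ∷ v ∷ x ∷ y ∷ z ∷ []) 6 2 3 t→v
                ((0 ⟶ 2 , a→t) ∷ (1 ⟶ 2 , b→t) ∷ (3 ⟶ 4 , v→x) ∷ (4 ⟶ 5 , x→y) ∷ (5 ⟶ 6 , y→z) ∷
                 (2 !⟶ 3 , t!→v) ∷ (2 ⟶! 3 , t→!v) ∷ (3 ⟶! 4 , v→!x) ∷ (4 ⟶! 5 , x→!y) ∷
                 (0 # 1 , a≢b) ∷ [])
  ...     | z , y→z | inj₂ (d , d≢x , d→y) = killing
                (a ∷ b ∷ t ∷ v ∷ x ∷ y ∷ z ∷ d ∷ []) 6 5 6 y→z
                ((0 ⟶ 2 , a→t) ∷ (1 ⟶ 2 , b→t) ∷ (2 ⟶ 3 , t→v) ∷ (3 ⟶ 4 , v→x) ∷ (4 ⟶ 5 , x→y) ∷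
                 (7 ⟶ 5 , d→y) ∷
                 (2 !⟶ 3 , t!→v) ∷ (3 !⟶ 4 , v!→x) ∷ (4 !⟶ 5 , x!→y) ∷
                 (5 !⟶ 6 , merge-only-out d≢x d→y x→y y→z) ∷
                 (0 # 1 , a≢b) ∷ (7 # 4 , d≢x) ∷ [])

  -- The second alternative is a bottleneck, a single arc from a merging vertex to a branching one.
  -- Every other shape of `v` already yields six arcs.
  merge : ∀ {a b t v} → a ≢ b → T (A a t) → T (A b t) → T (A t v) →
    Killing A 6 ⊎ (OnlyIn A t v × ∃₂ λ c d → c ≢ d × T (A v c) × T (A v d))
  merge {t = t} {v} a≢b a→t b→t t→v with has-out t→v | in-split t v
  ... | _ | inj₂ (c , c≢t , c→v) = inj₁ (merge-merge a≢b a→t b→t t→v c≢t c→v)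
  ... | x , v→x | inj₁ t→!v with out-split v x
  ...   | inj₁ v!→x = inj₁ (merge-straight a≢b a→t b→t t→v t→!v v→x v!→x)
  ...   | inj₂ (d , d≢x , v→d) = inj₂ (t→!v , d , x , d≢x , v→d , v→x)

  -- Cutting the bottleneck arc kills two arcs on each side, and the arc from `e` to `a` as well
  -- because its only continuation is gone.
  merge-after : ∀ {e a b t v} → a ≢ b → T (A e a) → OnlyOut A a t → T (A a t) → T (A b t) → T (A t v) → Killing A 6
  merge-after {e} {a} {b} {t} {v} a≢b e→a a!→t a→t b→t t→v with merge a≢b a→t b→t t→v
  ... | inj₁ K = K
  ... | inj₂ (t→!v , c , d , c≢d , v→c , v→d) = killing
          (e ∷ a ∷ b ∷ t ∷ v ∷ c ∷ d ∷ []) 6 3 4 t→v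
          ((0 ⟶ 1 , e→a) ∷ (1 ⟶ 3 , a→t) ∷ (2 ⟶ 3 , b→t) ∷ (4 ⟶ 5 , v→c) ∷ (4 ⟶ 6 , v→d) ∷
           (1 !⟶ 3 , a!→t) ∷ (3 !⟶ 4 , merge-only-out a≢b a→t b→t t→v) ∷ (3 ⟶! 4 , t→!v) ∷
           (1 # 2 , a≢b) ∷ (5 # 6 , c≢d) ∷ [])

  6⇒5 : Killing A 6 → Killing A 5
  6⇒5 (R , K , 6≤) = R , K , <⇒≤ 6≤

  merge-5 : ∀ {a b t v} → a ≢ b → T (A a t) → T (A b t) → T (A t v) → Killing A 5
  merge-5 {a} {b} {t} {v} a≢b a→t b→t t→v with merge a≢b a→t b→t t→v
  ... | inj₁ K = 6⇒5 K
  ... | inj₂ (t→!v , c , d , c≢d , v→c , v→d) = killing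
          (a ∷ b ∷ t ∷ v ∷ c ∷ d ∷ []) 5 2 3 t→v
          ((0 ⟶ 2 , a→t) ∷ (1 ⟶ 2 , b→t) ∷ (3 ⟶ 4 , v→c) ∷ (3 ⟶ 5 , v→d) ∷
           (2 !⟶ 3 , merge-only-out a≢b a→t b→t t→v) ∷ (2 ⟶! 3 , t→!v) ∷
           (0 # 1 , a≢b) ∷ (4 # 5 , c≢d) ∷ [])

  -- A unique out-neighbour of `v` excludes the bottleneck.
  merge-before : ∀ {a b t v x} → a ≢ b → T (A a t) → T (A b t) → T (A t v) → OnlyOut A v x → Killing A 6
  merge-before a≢b a→t b→t t→v v!→x with merge a≢b a→t b→t t→v
  ... | inj₁ K = K
  ... | inj₂ (_ , c , d , c≢d , v→c , v→d) = ⊥-elim (c≢d (trans (v!→x c v→c) (sym (v!→x d v→d))))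

  -- One extra arc for a forward cascade from `q`: a second arc out of `p`, or an arc into `q` to be
  -- cut instead. Failing both, `q` merges just before the unbranched `p`.
  behind : ∀ {q p w} → T (A q p) → T (A p w) →
    Killing A 6 ⊎ (∃ λ r → r ≢ w × T (A p r)) ⊎ (∃ λ r → T (A r q) × OnlyIn A r q)
  behind {q} {p} {w} q→p p→w with out-split p w | has-in q→p
  ... | inj₂ branch | _ = inj₂ (inj₁ branch)
  ... | inj₁ p!→w | r , r→q with in-split r q
  ...   | inj₁ r→!q = inj₂ (inj₂ (r , r→q , r→!q))
  ...   | inj₂ (b , b≢r , b→q) = inj₁ (merge-before b≢r b→q r→q q→p p!→w)

  -- One extra arc at the far end of the cascade: a second arc out of `y`, or an arc out of `z` that
  -- dies with the one from `y`.
  ahead : ∀ {w y z} → T (A w y) → T (A y z) →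
    Killing A 6 ⊎ (∃ λ s → s ≢ z × T (A y s)) ⊎ (OnlyIn A y z × ∃ λ s → T (A z s))
  ahead {w} {y} {z} w→y y→z with out-split y z | has-out y→z
  ... | inj₂ branch | _ = inj₂ (inj₁ branch)
  ... | inj₁ y!→z | s , z→s with in-split y z
  ...   | inj₁ y→!z = inj₂ (inj₂ (y→!z , s , z→s))
  ...   | inj₂ (b , b≢y , b→z) = inj₁ (merge-after (b≢y ∘ sym) w→y y!→z y→z b→z z→s)

  -- Sole in-neighbours make the four arcs from `q` to `z` die in turn; `behind` and `ahead`
  -- contribute one more each.
  through-straight : ∀ {q p w y} → T (A q p) → OnlyIn A q p → T (A p w) → OnlyIn A p w →
    T (A w y) → OnlyIn A w y → Killing A 6
  through-straight {q} {p} {w} {y} q→p q→!p p→w p→!w w→y w→!y with has-out w→y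
  ... | z , y→z with behind q→p p→w | ahead w→y y→z
  ...   | inj₁ K | _ = K
  ...   | _ | inj₁ K = K
  ...   | inj₂ (inj₁ (r , r≢w , p→r)) | inj₂ (inj₁ (s , s≢z , y→s)) = killing
          (q ∷ p ∷ w ∷ y ∷ z ∷ r ∷ s ∷ []) 6 0 1 q→p
          ((1 ⟶ 2 , p→w) ∷ (2 ⟶ 3 , w→y) ∷ (3 ⟶ 4 , y→z) ∷ (1 ⟶ 5 , p→r) ∷ (3 ⟶ 6 , y→s) ∷
           (0 ⟶! 1 , q→!p) ∷ (1 ⟶! 2 , p→!w) ∷ (2 ⟶! 3 , w→!y) ∷
           (5 # 2 , r≢w) ∷ (6 # 4 , s≢z) ∷ [])
  ...   | inj₂ (inj₁ (r , r≢w , p→r)) | inj₂ (inj₂ (y→!z , s , z→s)) = killing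
          (q ∷ p ∷ w ∷ y ∷ z ∷ r ∷ s ∷ []) 6 0 1 q→p
          ((1 ⟶ 2 , p→w) ∷ (2 ⟶ 3 , w→y) ∷ (3 ⟶ 4 , y→z) ∷ (1 ⟶ 5 , p→r) ∷ (4 ⟶ 6 , z→s) ∷
           (0 ⟶! 1 , q→!p) ∷ (1 ⟶! 2 , p→!w) ∷ (2 ⟶! 3 , w→!y) ∷ (3 ⟶! 4 , y→!z) ∷
           (5 # 2 , r≢w) ∷ [])
  ...   | inj₂ (inj₂ (r , r→q , r→!q)) | inj₂ (inj₁ (s , s≢z , y→s)) = killing
          (q ∷ p ∷ w ∷ y ∷ z ∷ r ∷ s ∷ []) 6 5 0 r→q
          ((0 ⟶ 1 , q→p) ∷ (1 ⟶ 2 , p→w) ∷ (2 ⟶ 3 , w→y) ∷ (3 ⟶ 4 , y→z) ∷ (3 ⟶ 6 , y→s) ∷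
           (5 ⟶! 0 , r→!q) ∷ (0 ⟶! 1 , q→!p) ∷ (1 ⟶! 2 , p→!w) ∷ (2 ⟶! 3 , w→!y) ∷
           (6 # 4 , s≢z) ∷ [])
  ...   | inj₂ (inj₂ (r , r→q , r→!q)) | inj₂ (inj₂ (y→!z , s , z→s)) = killing
          (q ∷ p ∷ w ∷ y ∷ z ∷ r ∷ s ∷ []) 6 5 0 r→q
          ((0 ⟶ 1 , q→p) ∷ (1 ⟶ 2 , p→w) ∷ (2 ⟶ 3 , w→y) ∷ (3 ⟶ 4 , y→z) ∷ (4 ⟶ 6 , z→s) ∷
           (5 ⟶! 0 , r→!q) ∷ (0 ⟶! 1 , q→!p) ∷ (1 ⟶! 2 , p→!w) ∷ (2 ⟶! 3 , w→!y) ∷ (3 ⟶! 4 , y→!z) ∷ [])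

  -- Here `w` has degree 2. A second arc into `y` or `p` creates a merging vertex next to `w`;
  -- otherwise the path is straight.
  through : ∀ {p w y} → T (A p w) → T (A w y) → OnlyIn A p w → OnlyOut A w y → Killing A 6
  through {p} {w} {y} p→w w→y p→!w w!→y with has-in p→w | has-out w→y | in-split w y
  ... | _ | z , y→z | inj₂ (b , b≢w , b→y) = merge-after (b≢w ∘ sym) p→w w!→y w→y b→y y→z
  ... | q , q→p | _ | inj₁ w→!y with in-split q p
  ...   | inj₁ q→!p = through-straight q→p q→!p p→w p→!w w→y w→!y
  ...   | inj₂ (b , b≢q , b→p) = merge-before b≢q b→p q→p p→w w!→y

  -- Merging or degree 2 at `u` or `v` is settled above. Otherwise both branch and have sole
  -- in-neighbours, so cutting the arc into `u` kills two arcs out of each.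
  kill-5 : ∀ {u v} → T (A u v) → Killing A 5
  kill-5 {u} {v} u→v with x , v→x ← has-out u→v | q , q→u ← has-in u→v | in-split u v | out-split v x
  ... | inj₂ (b , b≢u , b→v) | _ = merge-5 b≢u b→v u→v v→x
  ... | inj₁ u→!v | inj₁ v!→x = 6⇒5 (through u→v v→x u→!v v!→x)
  ... | inj₁ u→!v | inj₂ (d , d≢x , v→d) with in-split q u | out-split u v
  ...   | inj₂ (b , b≢q , b→u) | _ = merge-5 b≢q b→u q→u u→v
  ...   | inj₁ q→!u | inj₁ u!→v = 6⇒5 (through q→u u→v q→!u u!→v)
  ...   | inj₁ q→!u | inj₂ (r , r≢v , u→r) = killing
          (q ∷ u ∷ v ∷ x ∷ d ∷ r ∷ []) 5 0 1 q→u
          ((1 ⟶ 2 , u→v) ∷ (1 ⟶ 5 , u→r) ∷ (2 ⟶ 3 , v→x) ∷ (2 ⟶ 4 , v→d) ∷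
           (0 ⟶! 1 , q→!u) ∷ (1 ⟶! 2 , u→!v) ∷ (4 # 3 , d≢x) ∷ (5 # 2 , r≢v) ∷ [])

  -- Without in-arcs `v` has no arcs at all, degree 2 is the case of `through`, and otherwise three
  -- arcs exhaust the degree bound.
  kill-6-or-3∣degree : ∀ v → Killing A 6 ⊎ 3 ∣ degree A v
  kill-6-or-3∣degree v with any? (λ u → T? (A u v))
  ... | no no-in = inj₂ (subst (3 ∣_) (sym (cong₂ _+_
          (count-none (A v) λ u v→u → no-in (has-in v→u)) (count-none (λ u → A u v) λ u u→v → no-in (u , u→v)))) (3 ∣0))
  ... | yes (p , p→v) with y , v→y ← has-out p→v | in-split p v | out-split v y
  ...   | inj₁ p→!v | inj₁ v!→y = inj₁ (through p→v v→y p→!v v!→y)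
  ...   | inj₂ (b , b≢p , b→v) | _ = inj₂ (subst (3 ∣_)
            (≤-antisym (+-mono-≤ (count-≥1 (A v) v→y) (count-≥2 (λ u → A u v) b≢p b→v p→v)) (deg v)) ∣-refl)
  ...   | inj₁ _ | inj₂ (d , d≢y , v→d) = inj₂ (subst (3 ∣_)
            (≤-antisym (+-mono-≤ (count-≥2 (A v) d≢y v→d v→y) (count-≥1 (λ u → A u v) p→v)) (deg v)) ∣-refl)

  -- If 3 divides all degrees, it divides twice the number of arcs by the handshake identity, hence
  -- that number.
  kill-6-or-3∣arcs : Killing A 6 ⊎ 3 ∣ arcs A
  kill-6-or-3∣arcs with all? (λ v → 3 ∣? degree A v)
  ... | yes 3∣ = inj₂ (∣m+n∣m⇒∣n
    (subst (3 ∣_) (trans (*-comm 3 (arcs A)) (triple (arcs A))) (m∣m*n (arcs A)))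
    (subst (3 ∣_) (∑degree A) (∣-sum 3∣ (allFin n))))
  ... | no ¬3∣ with v , ¬3∣v ← ¬∀⟶∃¬ n _ (λ v → 3 ∣? degree A v) ¬3∣ | kill-6-or-3∣degree v
  ...   | inj₁ K   = inj₁ K
  ...   | inj₂ 3∣v = ⊥-elim (¬3∣v 3∣v)

-- Induction on the number of arcs.

HasFAS-≤ : ∀ {A : Digraph n} {M N} → M ≤ N → HasFAS A M → HasFAS A N
HasFAS-≤ M≤N (F , fas , size) = F , fas , ≤-trans size M≤N

-- Recursion is on the bound `N`, which drops by one even when several arcs disappear.
sparse-HasFAS : ∀ N (A : Digraph n) → arcs A ≤ N → Sparse A → HasFAS A (arcs A)
sparse-HasFAS {n} N A bound sparse@(deg , girth) with any? (λ u → any? (λ v → T? (A u v)))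
... | no none = A , ((λ _ _ → id) , λ m C → none (_ , _ , ∧-left (arc C zero))) ,
    ≤-reflexive (trans (cong (6 *_) arcs≡0) (sym arcs≡0))
  where
  arcs≡0 : arcs A ≡ 0
  arcs≡0 = n≤0⇒n≡0 (≤-trans
    (sum-map-mono (λ u → ≤-reflexive (count-none (A u) λ v u→v → none (u , v , u→v))) (allFin n))
    (≤-reflexive (sum-map-0 (allFin n))))
sparse-HasFAS zero A bound sparse | yes (u , v , u→v) =
  contradiction (≤-trans (arcs-delete A u→v) bound) λ ()
sparse-HasFAS {n} (suc N) A bound sparse@(deg , girth) | yes (u , v , u→v)
  -- Look for an arc whose tail has no in-arc or whose head has no out-arc; it is discarded at no
  -- cost.
  with any? (λ x → any? (λ y → T? (A x y) ×-dec
         (¬? (any? (λ z → T? (A z x))) ⊎-dec ¬? (any? (λ z → T? (A y z))))))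
... | yes (x , y , x→y , dead-end) =
  HasFAS-dead A (case dead-end of λ
    { (inj₁ f) → inj₁ λ z h → f (z , h)
    ; (inj₂ f) → inj₂ λ z h → f (z , h) })
    (HasFAS-≤ (<⇒≤ fewer)
      (sparse-HasFAS N (delete A (x , y)) (s≤s⁻¹ (≤-trans fewer bound)) (Sparse-⊆ (delete-⊆ A) sparse)))
  where
  fewer : arcs (delete A (x , y)) < arcs A
  fewer = arcs-delete A x→y
... | no alive = finish kill-6-or-3∣arcs
  where
  has-in : ∀ {x y} → T (A x y) → ∃ λ z → T (A z x)
  has-in {x} {y} x→y = decidable-stable (any? (λ z → T? (A z x))) λ ¬in →
    alive (x , y , x→y , inj₁ ¬in)
  has-out : ∀ {x y} → T (A x y) → ∃ λ z → T (A y z)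
  has-out {x} {y} x→y = decidable-stable (any? (λ z → T? (A y z))) λ ¬out →
    alive (x , y , x→y , inj₂ ¬out)
  open Core deg (no-short-closed girth) has-in has-out

  after-killing : ∀ {c} → Killing A (suc c) → ∃ λ M → suc c + M ≤ arcs A × HasFAS A (6 + M)
  after-killing {c} (R , K , c<R) = arcs (A ∖ R) , fewer ,
    Kills-HasFAS A K (sparse-HasFAS N (A ∖ R)
      (s≤s⁻¹ (≤-trans (s≤s (m≤n+m _ c)) (≤-trans fewer bound))) (Sparse-⊆ (∖-⊆ A R) sparse))
    where
    fewer : suc c + arcs (A ∖ R) ≤ arcs A
    fewer = ≤-trans (+-monoˡ-≤ _ c<R) (Kills-arcs A K)

  -- With five arcs killed the induction hypothesis gives 6|F| ≤ a + 1 only;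
  -- as 3 divides both a and 6|F|, equality cannot hold.
  finish : Killing A 6 ⊎ 3 ∣ arcs A → HasFAS A (arcs A)
  finish (inj₁ K) with _ , fewer , fas ← after-killing K = HasFAS-≤ fewer fas
  finish (inj₂ 3∣a) with _ , fewer , F , fas , size ← after-killing (kill-5 u→v) =
    F , fas , [ s≤s⁻¹ , (λ e → contradiction (3∣1 e) λ { (divides (suc _) ()) }) ]′
      (m≤n⇒m<n∨m≡n (≤-trans size (s≤s fewer)))
    where
    3∣1 : 6 * arcs F ≡ 1 + arcs A → 3 ∣ 1
    3∣1 e = ∣m+n∣m⇒∣n (subst (3 ∣_) (trans e (+-comm 1 (arcs A))) (∣-trans (divides 2 refl) (m∣m*n (arcs F)))) 3∣a

-- The directed 6-cycle and the lower bound.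

increasing⇒acyclic : {B : Digraph n} → (∀ u v → T (B u v) → toℕ u < toℕ v) → Acyclic B
increasing⇒acyclic {n} incr m C = let i , n≤i = climb n in <⇒≱ (toℕ<n (vtx C i)) n≤i
  where
  -- Vertex numbers rise at each step around the cycle, so they reach every bound, even `n`.
  climb : ∀ r → ∃ λ i → r ≤ toℕ (vtx C i)
  climb zero = zero , z≤n
  climb (suc r) with i , r≤ ← climb r = nextIdx i , ≤-trans (s≤s r≤) (incr _ _ (arc C i))

hexagon : Digraph 6
hexagon u v = does (v ≟ nextIdx u)

-- A directed cycle is closed under the successor map, so it visits all six vertices; choosing an
-- index for each is injective.
hexagon-girth : GirthAtLeast hexagon 6
hexagon-girth m C = injective⇒≤ {f = proj₁ ∘ visited}
  λ {u} {v} e → trans (sym (proj₂ (visited u))) (trans (cong (vtx C) e) (proj₂ (visited v)))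
  where
  Visited : Fin 6 → Set
  Visited v = ∃ λ i → vtx C i ≡ v
  step : ∀ {v} → Visited v → Visited (nextIdx v)
  -- Matching on `arc C i` refutes the `no` case.
  step (i , refl) with yes e ← vtx C (nextIdx i) ≟ nextIdx (vtx C i) | _ ← arc C i = nextIdx i , e
  from-start : ∀ v → Visited v → Visited 0F
  from-start 0F = id
  from-start 1F = step ∘ step ∘ step ∘ step ∘ step
  from-start 2F = step ∘ step ∘ step ∘ step
  from-start 3F = step ∘ step ∘ step
  from-start 4F = step ∘ step
  from-start 5F = step
  visited-0 : Visited 0F
  visited-0 = from-start (vtx C zero) (zero , refl)
  visited : ∀ v → Visited v
  visited 0F = visited-0
  visited 1F = step visited-0
  visited 2F = step (step visited-0)
  visited 3F = step (step (step visited-0))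
  visited 4F = step (step (step (step visited-0)))
  visited 5F = step (step (step (step (step visited-0))))

hexagon-admissible : Admissible hexagon 3 6
hexagon-admissible =
  ( toWitness {a? = all? λ v → ¬? (T? (hexagon v v))} _
  , toWitness {a? = all? λ u → all? λ v → T? (hexagon u v) →-dec ¬? (T? (hexagon v u))} _ )
  , s≤s z≤n
  , toWitness {a? = all? λ v → degree hexagon v ≤? 3} _
  , hexagon-girth

-- Without the arc from 5 to 0 all arcs increase the vertex number; with nothing removed the 6-cycle
-- survives.
hexagon-fas : IsFas hexagon 1
hexagon-fas = (single 5F 0F , (sub , increasing⇒acyclic rises) , refl) , least
  where
  sub : single 5F 0F ⊆ hexagon
  sub u v h with refl , refl ← T-single 5F 0F u v h = tt
  rises : ∀ u v → T (removeArcs hexagon (single 5F 0F) u v) → toℕ u < toℕ v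
  rises = toWitness {a? = all? λ u → all? λ v →
    T? (removeArcs hexagon (single 5F 0F) u v) →-dec (toℕ u <? toℕ v)} _
  least : ∀ F → IsFAS hexagon F → 1 ≤ arcs F
  least F (_ , acyclic) with any? (λ u → any? (λ v → T? (F u v)))
  ... | yes (_ , _ , u→v) = ≤-trans (s≤s z≤n) (arcs-delete F u→v)
  ... | no none = ⊥-elim (acyclic 5 record
    { vtx = id ; distinct = id ; arc = λ i → T-∖ (around i) (λ h → none (_ , _ , h)) })
    where
    around : ∀ i → T (hexagon i (nextIdx i))
    around = toWitness {a? = all? λ i → T? (hexagon i (nextIdx i))} _

-- The supremum in integers: with `a` arcs, the second part says `f / a > 1/6 - 1/k` for every
-- positive `k`.
theorem4 : ((n : ℕ) (A : Digraph n) → Admissible A 3 6 →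
    (f : ℕ) → IsFas A f → 6 * f ≤ arcs A)
    ×
    ((k : ℕ) → 1 ≤ k →
    Σ ℕ λ n → Σ (Digraph n) λ A → Admissible A 3 6 ×
    (Σ ℕ λ f → IsFas A f × k * arcs A < 6 * k * f + 6 * arcs A))
theorem4 = upper , λ k _ → 6 , hexagon , hexagon-admissible , 1 , hexagon-fas ,
    -- For the hexagon `a = 6` and `f = 1`, so the claim is `6k < 6k + 36`.
    subst (_< 6 * k * 1 + 36) (trans (*-identityʳ (6 * k)) (*-comm 6 k)) (m<m+n (6 * k * 1) (s≤s z≤n))
  where
  upper : ∀ n (A : Digraph n) → Admissible A 3 6 → ∀ f → IsFas A f → 6 * f ≤ arcs A
  upper n A (_ , _ , sparse) f (_ , least) with F , fas , size ← sparse-HasFAS _ A ≤-refl sparse =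
    ≤-trans (*-monoʳ-≤ 6 (least F fas)) size
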